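{- Let $G$ be a chordal bipartite graph. The following statements are equivalent: (i) $G$ does not contain any induced domino; (ii) every graph in the orbit of $G$ is a chordal bipartite graph.
   Context: Graphs are finite and simple. A hole in a bipartite graph is an induced subgraph isomorphic to a cycle $C_n$ with $n\ge 6$. A chordal bipartite graph is a bipartite graph without holes. The domino is the graph obtained from the cycle $C_6$ by joining two antipodal vertices by a chord. Pivoting: for a bipartite graph $G$ and an edge $uv\in E(G)$, $G^{uv}$ is the graph on vertex set $V(G)$ with edge set $E(G)\,\Delta\,\{ab : a\in N_G(u)\setminus\{v\},\ b\in N_G(v)\setminus\{u\}\}$ (if $G$ is labeled, the labels of $u$ and $v$ are moreover interchanged; this is irrelevant up to isomorphism). The orbit of $G$ consists of all graphs $\widetilde G$ for which there are $k\ge 1$ and graphs $G_1,\dots,G_k$ with $G_1\cong G$, $G_k\cong\widetilde G$ and, for each $i=1,\dots,k-1$, $G_{i+1}\cong G_i^{e_i}$ for some $e_i\in E(G_i)$. -}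

module Defs where

open import Level using (0ℓ)
open import Data.Bool.Base using (Bool)
open import Data.Fin.Base using (Fin; toℕ)
open import Data.Fin.Patterns using (0F; 3F)
import Data.Fin.Base as Fin
import Data.Fin.Properties as Fin
open import Data.Nat.Base using (ℕ; suc; _≤_; s≤s; z≤n)
open import Data.Nat.Properties using (_≟_; ≤-trans; 1+n≢n)
open import Data.Product.Base using (Σ-syntax; ∃-syntax; _×_; _,_; swap)
open import Data.Sum.Base using (_⊎_; inj₁; inj₂; [_,_]′)
import Data.Sum.Base as Sum
open import Function.Base using (_∘_)
open import Function.Bundles using (_↔_; _↣_; _⇔_; Inverse; Injection)
open import Relation.Binary.Core using (Rel)
open import Relation.Binary.Definitions using (Decidable; Symmetric)
open import Relation.Binary.PropositionalEquality.Core
  using (_≡_; _≢_; refl; sym; trans; cong)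
open import Relation.Nullary.Decidable.Core using (_×-dec_; _⊎-dec_; ¬?)
open import Relation.Nullary.Negation.Core using (¬_)

record Graph : Set₁ where
  field
    order : ℕ

  Vertex : Set
  Vertex = Fin order

  field
    _~_      : Rel Vertex 0ℓ
    _~?_     : Decidable _~_
    ~-sym    : Symmetric _~_
    ~-irrefl : ∀ {v} → ¬ (v ~ v)

  Edge : Set
  Edge = Σ[ u ∈ Vertex ] Σ[ v ∈ Vertex ] u ~ v

open Graph using (Vertex; Edge)

infix 4 _≅_ _⊑_

_≅_ : Graph → Graph → Set
G ≅ H = Σ[ f ∈ Vertex G ↔ Vertex H ]
          (∀ u v → (u G.~ v) ⇔ (Inverse.to f u H.~ Inverse.to f v))
  where
  module G = Graph G
  module H = Graph H

-- H ⊑ G: some induced subgraph of G (the one on the image of f) is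
-- isomorphic to H.
_⊑_ : Graph → Graph → Set
H ⊑ G = Σ[ f ∈ Vertex H ↣ Vertex G ]
          (∀ u v → (u H.~ v) ⇔ (Injection.to f u G.~ Injection.to f v))
  where
  module G = Graph G
  module H = Graph H

Bipartite : Graph → Set
Bipartite G = Σ[ side ∈ (Vertex G → Bool) ] (∀ {u v} → u ~ v → side u ≢ side v)
  where open Graph G using (_~_)

Next : ∀ n → Rel (Fin n) 0ℓ
Next n i j = (toℕ j ≡ suc (toℕ i)) ⊎ (suc (toℕ i) ≡ n × toℕ j ≡ 0)

next? : ∀ n → Decidable (Next n)
next? n i j = (toℕ j ≟ suc (toℕ i)) ⊎-dec ((suc (toℕ i) ≟ n) ×-dec (toℕ j ≟ 0))

next-irrefl : ∀ {n} → 3 ≤ n → ∀ {i} → ¬ Next n i i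
next-irrefl _   (inj₁ i≡1+i)          = 1+n≢n (sym i≡1+i)
next-irrefl 3≤n (inj₂ (1+i≡n , i≡0)) with trans (sym (cong suc i≡0)) 1+i≡n
next-irrefl (s≤s ()) (inj₂ _) | refl

cycle : ∀ n → 3 ≤ n → Graph
cycle n 3≤n = record
  { order    = n
  ; _~_      = λ i j → Next n i j ⊎ Next n j i
  ; _~?_     = λ i j → next? n i j ⊎-dec next? n j i
  ; ~-sym    = Sum.swap
  ; ~-irrefl = [ next-irrefl 3≤n , next-irrefl 3≤n ]′
  }

addEdge : (G : Graph) (u v : Vertex G) → u ≢ v → Graph
addEdge G u v u≢v = record
  { order    = order
  ; _~_      = λ a b → (a ~ b) ⊎ ((a ≡ u × b ≡ v) ⊎ (b ≡ u × a ≡ v))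
  ; _~?_     = λ a b → (a ~? b) ⊎-dec
      (((a Fin.≟ u) ×-dec (b Fin.≟ v)) ⊎-dec ((b Fin.≟ u) ×-dec (a Fin.≟ v)))
  ; ~-sym    = Sum.map ~-sym Sum.swap
  ; ~-irrefl = [ ~-irrefl , [ loop , loop ]′ ]′
  }
  where
  open Graph G hiding (Vertex; Edge)
  loop : ∀ {a} → ¬ (a ≡ u × a ≡ v)
  loop (a≡u , a≡v) = u≢v (trans (sym a≡u) a≡v)

3≤6 : 3 ≤ 6
3≤6 = s≤s (s≤s (s≤s z≤n))

domino : Graph
domino = addEdge (cycle 6 3≤6) 0F 3F (λ ())

HasHole : Graph → Set
HasHole G = ∃[ n ] Σ[ 6≤n ∈ 6 ≤ n ] cycle n (≤-trans 3≤6 6≤n) ⊑ G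

ChordalBipartite : Graph → Set
ChordalBipartite G = Bipartite G × ¬ HasHole G

infix 3 _△_

_△_ : Set → Set → Set
A △ B = (A × ¬ B) ⊎ (B × ¬ A)

-- The labels of u and v are not interchanged.  The condition a ≢ b in Toggled
-- makes pivot total on graphs; when G is bipartite it is automatic, because u
-- and v then have no common neighbour.
pivot : (G : Graph) → Edge G → Graph
pivot G (u , v , _) = record
  { order    = order
  ; _~_      = λ a b → (a ~ b) △ Toggled a b
  ; _~?_     = λ a b → ((a ~? b) ×-dec ¬? (toggled? a b)) ⊎-dec
                       (toggled? a b ×-dec ¬? (a ~? b))
  ; ~-sym    = Sum.map (λ (p , ¬q) → ~-sym p , ¬q ∘ toggled-sym)
                       (λ (q , ¬p) → toggled-sym q , ¬p ∘ ~-sym)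
  ; ~-irrefl = [ (λ (p , _) → ~-irrefl p) , (λ ((a≢a , _) , _) → a≢a refl) ]′
  }
  where
  open Graph G hiding (Vertex; Edge)

  Cross : Rel (Vertex G) 0ℓ
  Cross a b = (u ~ a × a ≢ v) × (v ~ b × b ≢ u)

  cross? : Decidable Cross
  cross? a b = ((u ~? a) ×-dec ¬? (a Fin.≟ v)) ×-dec ((v ~? b) ×-dec ¬? (b Fin.≟ u))

  Toggled : Rel (Vertex G) 0ℓ
  Toggled a b = a ≢ b × (Cross a b ⊎ Cross b a)

  toggled? : Decidable Toggled
  toggled? a b = ¬? (a Fin.≟ b) ×-dec (cross? a b ⊎-dec cross? b a)

  toggled-sym : Symmetric Toggled
  toggled-sym (a≢b , c) = a≢b ∘ sym , Sum.swap c

-- The sequence G₁, …, Gₖ with k ≥ 1 is indexed by Fin (suc m), so k = suc m.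
_∈Orbit_ : Graph → Graph → Set₁
G̃ ∈Orbit G =
  ∃[ m ] Σ[ Gs ∈ (Fin (suc m) → Graph) ]
    (Gs Fin.zero ≅ G) ×
    (Gs (Fin.fromℕ m) ≅ G̃) ×
    (∀ (i : Fin m) → Σ[ e ∈ Edge (Gs (Fin.inject₁ i)) ]
                       (Gs (Fin.suc i) ≅ pivot (Gs (Fin.inject₁ i)) e))

{-# OPTIONS --safe #-}

-- Call a vertex z obstructed if some walk x … y avoiding the closed neighbourhood
-- of z, and some neighbours a, a′ of z, satisfy a ~ x, a′ ~ y and a ≁ y.  A
-- bipartite graph without holes and induced dominoes has no obstructed vertex: cut
-- a walk where it meets vertices at distance 2 from z, and shortcut the pieces to
-- induced paths.  Conversely all vertices of a hole and four vertices of a domino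
-- are obstructed, among them the ends c₁, c₂, c₃, c₄ of an induced 2K₂.
--
-- If G has no obstructed vertex, an obstructed vertex of the pivot at uv is
-- neither u nor v and is adjacent in G to u or v.  A hole or domino in the pivot
-- thus has its 2K₂ inside the part complemented by pivoting, and in G the vertices
-- u, v, c₁, …, c₄ induce a domino.  So the class is closed under pivoting.
-- Conversely, pivoting a domino at an edge that meets no vertex of degree 3
-- yields a 6-cycle.
module Submission where

open import Defs
open import Data.Bool.Base using (Bool; not)
open import Data.Bool.Properties using (¬-not; not-involutive)
open import Data.Empty using (⊥-elim)
open import Data.Fin.Base using (Fin; zero; suc; toℕ; fromℕ; inject₁)
open import Data.Fin.Induction using (<-weakInduction; >-weakInduction)
open import Data.Fin.Patterns using (0F; 1F; 2F; 3F; 4F; 5F)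
import Data.Fin.Properties as Fin
open import Data.Fin.Properties using
  (all?; any?; toℕ-injective; inject₁-injective; fromℕ≢inject₁; toℕ-fromℕ; toℕ-inject₁)
open import Data.List.Base using (List; []; _∷_; length; lookup)
open import Data.List.Membership.Propositional.Properties using (∈-lookup)
open import Data.List.Relation.Unary.All as All using (All; []; _∷_)
open import Data.List.Relation.Unary.All.Properties using (¬Any⇒All¬)
open import Data.List.Relation.Unary.Any as Any using (Any; here; there)
open import Data.Nat.Base as ℕ using (ℕ; suc; _≤_; s≤s; z≤n)
import Data.Nat.Properties as ℕ
open import Data.Product.Base using (Σ-syntax; ∃-syntax; ∃₂; _×_; _,_; proj₁; proj₂; swap)
open import Data.Product.Function.NonDependent.Propositional using (_×-⇔_)
open import Data.Sum.Base as Sum using (_⊎_; inj₁; inj₂; [_,_]′)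
open import Data.Sum.Function.Propositional using (_⊎-⇔_)
open import Data.Unit.Base using (tt)
open import Function.Base using (_∘_)
open import Function.Bundles using (_⇔_; mk⇔; mk↣; Equivalence; Inverse; Injection)
open import Function.Construct.Composition using (_⇔-∘_; _↣-∘_)
open import Function.Construct.Identity using (⇔-id; ↔-id; ↣-id)
open import Function.Construct.Symmetry using (⇔-sym; ↔-sym)
open import Function.Properties.Inverse using (↔⇒↣)
open import Function.Related.TypeIsomorphisms using (¬-cong-⇔)
open import Relation.Binary.PropositionalEquality
  using (_≡_; _≢_; refl; sym; trans; cong; subst; subst₂)
open import Relation.Nullary.Decidable using
  (Dec; yes; no; True; False; toWitness; toWitnessFalse; from-yes; ¬?; _×-dec_; _⊎-dec_; _→-dec_)
open import Relation.Nullary.Negation.Core using (¬_; contradiction)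

open Equivalence using (to; from)

-- Isomorphisms and induced subgraphs.

≅-sym : (G H : Graph) → G ≅ H → H ≅ G
≅-sym G H (f , p) = ↔-sym f , λ u v → ⇔-sym (p _ _) ⇔-∘
  mk⇔ (subst₂ (Graph._~_ H) (sym (right u)) (sym (right v)))
      (subst₂ (Graph._~_ H) (right u) (right v))
  where
  right : ∀ u → Inverse.to f (Inverse.from f u) ≡ u
  right u = Inverse.strictlyInverseˡ f u

≅⇒⊑ : (G H : Graph) → G ≅ H → G ⊑ H
≅⇒⊑ G H (f , p) = ↔⇒↣ f , p

⊑-trans : (F G H : Graph) → F ⊑ G → G ⊑ H → F ⊑ H
⊑-trans F G H (f , p) (g , q) = g ↣-∘ f , λ u v → q _ _ ⇔-∘ p u v

⊑-bipartite : (F G : Graph) → F ⊑ G → Bipartite G → Bipartite F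
⊑-bipartite F G (f , p) (side , proper) =
  side ∘ Injection.to f , λ e → proper (to (p _ _) e)

-- Obstructed vertices and their transfer along induced embeddings.

module Obstruction (G : Graph) where
  open Graph G

  Apart : Vertex → Vertex → Set
  Apart z w = z ≢ w × ¬ z ~ w

  ~⇒≢ : ∀ {u v} → u ~ v → u ≢ v
  ~⇒≢ e refl = ~-irrefl e

  data Reach (z x : Vertex) : Vertex → Set where
    start : Apart z x → Reach z x x
    step  : ∀ {w y} → Reach z x w → w ~ y → Apart z y → Reach z x y

  Obstructed : Vertex → Set
  Obstructed z = ∃₂ λ a a′ → ∃₂ λ x y →
    z ~ a × z ~ a′ × a ~ x × a′ ~ y × Reach z x y × ¬ a ~ y

  -- The common pattern of holes and dominoes. The vertex `m` serves to put `c₁` and `c₃` into the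
  -- same colour class of a bipartite graph.
  record Twisted : Set where
    field
      c₁ c₂ c₃ c₄ m : Vertex
      c₁~c₂ : c₁ ~ c₂
      c₃~c₄ : c₃ ~ c₄
      c₁≁c₄ : ¬ c₁ ~ c₄
      c₃≁c₂ : ¬ c₃ ~ c₂
      m~c₁ : m ~ c₁
      m~c₃ : m ~ c₃
      obstructed₁ : Obstructed c₁
      obstructed₂ : Obstructed c₂
      obstructed₃ : Obstructed c₃
      obstructed₄ : Obstructed c₄

module _ (F G : Graph) (F⊑G : F ⊑ G) where
  private
    module F where
      open Graph F public
      open Obstruction F public
    module G where
      open Graph G public
      open Obstruction G public
    f : F.Vertex → G.Vertex
    f = Injection.to (proj₁ F⊑G)

    edge : ∀ {u v} → u F.~ v → f u G.~ f v
    edge = to (proj₂ F⊑G _ _)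

    nonedge : ∀ {u v} → ¬ u F.~ v → ¬ f u G.~ f v
    nonedge n e = n (from (proj₂ F⊑G _ _) e)

    apart : ∀ {z w} → F.Apart z w → G.Apart (f z) (f w)
    apart (z≢w , z≁w) = z≢w ∘ Injection.injective (proj₁ F⊑G) , nonedge z≁w

    reach : ∀ {z x y} → F.Reach z x y → G.Reach (f z) (f x) (f y)
    reach (F.start p)    = G.start (apart p)
    reach (F.step r e p) = G.step (reach r) (edge e) (apart p)

  ⊑-obstructed : ∀ {z} → F.Obstructed z → G.Obstructed (f z)
  ⊑-obstructed (_ , _ , _ , _ , z~a , z~a′ , a~x , a′~y , r , a≁y) =
    _ , _ , _ , _ , edge z~a , edge z~a′ , edge a~x , edge a′~y , reach r , nonedge a≁y

  ⊑-twisted : F.Twisted → G.Twisted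
  ⊑-twisted t = record
    { c₁~c₂ = edge c₁~c₂ ; c₃~c₄ = edge c₃~c₄ ; c₁≁c₄ = nonedge c₁≁c₄ ; c₃≁c₂ = nonedge c₃≁c₂
    ; m~c₁ = edge m~c₁ ; m~c₃ = edge m~c₃
    ; obstructed₁ = ⊑-obstructed obstructed₁ ; obstructed₂ = ⊑-obstructed obstructed₂
    ; obstructed₃ = ⊑-obstructed obstructed₃ ; obstructed₄ = ⊑-obstructed obstructed₄
    }
    where open F.Twisted t

-- Obstructed vertices of the domino.

module _ where
  open Graph domino
  open Obstruction domino

  apart? : ∀ z w → Dec (Apart z w)
  apart? z w = ¬? (z Fin.≟ w) ×-dec ¬? (z ~? w)

  -- The vertices `z`, `a`, `x`, `m`, `y`, `a′` are meant to run once around the outer hexagon. On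
  -- closed vertices all conditions are settled by evaluation.
  domino-obstructed : ∀ z a a′ x m y →
    {_ : True (z ~? a)} {_ : True (z ~? a′)} {_ : True (a ~? x)} {_ : True (a′ ~? y)}
    {_ : True (x ~? m)} {_ : True (m ~? y)}
    {_ : True (apart? z x)} {_ : True (apart? z m)} {_ : True (apart? z y)} {_ : False (a ~? y)} →
    Obstructed z
  domino-obstructed z a a′ x m y {p₁} {p₂} {p₃} {p₄} {p₅} {p₆} {p₇} {p₈} {p₉} {p₁₀} =
    a , a′ , x , y , toWitness p₁ , toWitness p₂ , toWitness p₃ , toWitness p₄ ,
    step (step (start (toWitness p₇)) (toWitness p₅) (toWitness p₈)) (toWitness p₆) (toWitness p₉) ,
    toWitnessFalse p₁₀

  domino-twisted : Twisted
  domino-twisted = record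
    -- The chord joins `0F` and `3F`; the other four vertices induce two disjoint edges.
    { c₁ = 1F ; c₂ = 2F ; c₃ = 5F ; c₄ = 4F ; m = 0F
    ; c₁~c₂ = toWitness {a? = 1F ~? 2F} tt
    ; c₃~c₄ = toWitness {a? = 5F ~? 4F} tt
    ; c₁≁c₄ = toWitnessFalse {a? = 1F ~? 4F} tt
    ; c₃≁c₂ = toWitnessFalse {a? = 5F ~? 2F} tt
    ; m~c₁ = toWitness {a? = 0F ~? 1F} tt
    ; m~c₃ = toWitness {a? = 0F ~? 5F} tt
    ; obstructed₁ = domino-obstructed 1F 2F 0F 3F 4F 5F
    ; obstructed₂ = domino-obstructed 2F 1F 3F 0F 5F 4F
    ; obstructed₃ = domino-obstructed 5F 4F 0F 3F 2F 1F
    ; obstructed₄ = domino-obstructed 4F 5F 3F 0F 1F 2F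
    }

-- Rotations of cycles, and obstructed vertices of holes.

rotate : ∀ {k} → Fin (suc k) → Fin (suc k)
rotate zero    = fromℕ _
rotate (suc i) = inject₁ i

rotate-injective : ∀ {k} {i j : Fin (suc k)} → rotate i ≡ rotate j → i ≡ j
rotate-injective {i = zero}  {zero}  _  = refl
rotate-injective {i = zero}  {suc j} eq = contradiction eq fromℕ≢inject₁
rotate-injective {i = suc i} {zero}  eq = contradiction (sym eq) fromℕ≢inject₁
rotate-injective {i = suc i} {suc j} eq = cong suc (inject₁-injective eq)

rotate-next : ∀ {k} → 3 ≤ suc k → ∀ i j → Next (suc k) i j ⇔ Next (suc k) (rotate i) (rotate j)
rotate-next {k} 3≤n zero zero = mk⇔ (⊥-elim ∘ next-irrefl 3≤n) (⊥-elim ∘ next-irrefl 3≤n)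
rotate-next {k} 3≤n zero (suc j) = mk⇔ ⇒ ⇐
  where
  ⇒ : Next (suc k) zero (suc j) → Next (suc k) (fromℕ k) (inject₁ j)
  ⇒ (inj₁ eq) = inj₂ (cong suc (toℕ-fromℕ k) , trans (toℕ-inject₁ j) (ℕ.suc-injective eq))
  ⇒ (inj₂ (_ , ()))
  ⇐ : Next (suc k) (fromℕ k) (inject₁ j) → Next (suc k) zero (suc j)
  ⇐ (inj₁ eq) = contradiction (trans (sym (toℕ-inject₁ j)) (trans eq (cong suc (toℕ-fromℕ k))))
                  (ℕ.<⇒≢ (ℕ.<-trans (Fin.toℕ<n j) (ℕ.n<1+n k)))
  ⇐ (inj₂ (_ , eq)) = inj₁ (cong suc (trans (sym (toℕ-inject₁ j)) eq))
rotate-next {k} 3≤n (suc i) zero = mk⇔ ⇒ ⇐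
  where
  ⇒ : Next (suc k) (suc i) zero → Next (suc k) (inject₁ i) (fromℕ k)
  ⇒ (inj₂ (eq , _)) = inj₁ (trans (toℕ-fromℕ k) (sym (trans (cong suc (toℕ-inject₁ i)) (ℕ.suc-injective eq))))
  ⇐ : Next (suc k) (inject₁ i) (fromℕ k) → Next (suc k) (suc i) zero
  ⇐ (inj₁ eq) = inj₂ (cong suc (trans (cong suc (sym (toℕ-inject₁ i))) (trans (sym eq) (toℕ-fromℕ k))) , refl)
  -- A wrap-around edge into the last vertex would force `k` to be 0, which `3≤n` excludes.
  ⇐ (inj₂ (_ , eq)) = contradiction (subst (3 ≤_) (cong suc (trans (sym (toℕ-fromℕ k)) eq)) 3≤n) λ { (s≤s ()) }
rotate-next {k} 3≤n (suc i) (suc j) = mk⇔ ⇒ ⇐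
  where
  ⇒ : Next (suc k) (suc i) (suc j) → Next (suc k) (inject₁ i) (inject₁ j)
  ⇒ (inj₁ eq) = inj₁ (trans (toℕ-inject₁ j) (trans (ℕ.suc-injective eq) (cong suc (sym (toℕ-inject₁ i)))))
  ⇐ : Next (suc k) (inject₁ i) (inject₁ j) → Next (suc k) (suc i) (suc j)
  ⇐ (inj₁ eq) = inj₁ (cong suc (trans (sym (toℕ-inject₁ j)) (trans eq (cong suc (toℕ-inject₁ i)))))
  ⇐ (inj₂ (eq , _)) = contradiction (trans (sym (toℕ-inject₁ i)) (ℕ.suc-injective eq)) (ℕ.<⇒≢ (Fin.toℕ<n i))

rotation : ∀ {k} (3≤n : 3 ≤ suc k) → cycle (suc k) 3≤n ⊑ cycle (suc k) 3≤n
rotation 3≤n = mk↣ rotate-injective , λ i j → rotate-next 3≤n i j ⊎-⇔ rotate-next 3≤n j i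

module _ (k : ℕ) (3≤n : 3 ≤ 6 ℕ.+ k) where
  private
    C = cycle (6 ℕ.+ k) 3≤n
  open Graph C
  open Obstruction C

  private
    apart : (i : Vertex) → 2 ≤ toℕ i → suc (suc (toℕ i)) ≤ 6 ℕ.+ k → Apart 0F i
    apart i 2≤i i<n = (λ { refl → contradiction 2≤i λ () }) ,
      [ [ (λ eq → ℕ.<⇒≢ 2≤i (sym eq)) , (λ { (() , _) }) ]′
      , [ (λ ()) , (λ (eq , _) → ℕ.<⇒≢ i<n eq) ]′ ]′

    -- The upper bound keeps `i` at most n - 2, because n - 1 is a neighbour of `0F`.
    reach : ∀ j (i : Vertex) → toℕ i ≡ 2 ℕ.+ j → suc (suc (toℕ i)) ≤ 6 ℕ.+ k → Reach 0F 2F i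
    reach ℕ.zero i eq i<n with refl ← toℕ-injective {i = i} {j = 2F} eq =
      start (apart 2F (s≤s (s≤s z≤n)) i<n)
    reach (suc j) (suc i) eq i<n = step
      (reach j (inject₁ i) eq′ (subst (λ t → suc (suc t) ≤ 6 ℕ.+ k) (sym (toℕ-inject₁ i)) (ℕ.<⇒≤ i<n)))
      (inj₁ (inj₁ (cong suc (sym (toℕ-inject₁ i)))))
      (apart (suc i) (subst (2 ≤_) (sym eq) (s≤s (s≤s z≤n))) i<n)
      where eq′ = trans (toℕ-inject₁ i) (ℕ.suc-injective eq)

    final : Vertex
    final = inject₁ (fromℕ (4 ℕ.+ k))

    toℕ-final : toℕ final ≡ 4 ℕ.+ k
    toℕ-final = trans (toℕ-inject₁ (fromℕ (4 ℕ.+ k))) (toℕ-fromℕ (4 ℕ.+ k))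

    -- Without `0F` and its neighbours 1 and n - 1 the cycle is a path from 2 to `final`, which is n
    -- - 2. As n is at least 6, the vertices 1 and n - 2 are not adjacent.
    obstructed-0F : Obstructed 0F
    obstructed-0F = 1F , fromℕ (5 ℕ.+ k) , 2F , final ,
      inj₁ (inj₁ refl) ,
      inj₂ (inj₂ (cong suc (toℕ-fromℕ (5 ℕ.+ k)) , refl)) ,
      inj₁ (inj₁ refl) ,
      inj₂ (inj₁ (trans (toℕ-fromℕ (5 ℕ.+ k)) (cong suc (sym toℕ-final)))) ,
      reach (2 ℕ.+ k) final toℕ-final (ℕ.≤-reflexive (cong (2 ℕ.+_) toℕ-final)) ,
      nonadjacent
      where
      nonadjacent : ¬ 1F ~ final
      nonadjacent (inj₁ (inj₁ eq)) with () ← trans (sym toℕ-final) eq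
      nonadjacent (inj₂ (inj₁ eq)) with () ← trans (cong suc (sym toℕ-final)) (sym eq)

  cycle-obstructed : ∀ z → Obstructed z
  -- Rotating `0F` gives the last vertex, where the downward induction starts; rotating `suc i`
  -- gives `inject₁ i`, which is its step.
  cycle-obstructed = >-weakInduction Obstructed (rotated obstructed-0F) (λ _ → rotated)
    where
    rotated : ∀ {z} → Obstructed z → Obstructed (rotate z)
    rotated = ⊑-obstructed C C (rotation 3≤n)

  cycle-twisted : Twisted
  cycle-twisted = record
    -- Five consecutive vertices with the middle one as `m`.
    { c₁ = 1F ; c₂ = 0F ; c₃ = 3F ; c₄ = 4F ; m = 2F
    ; c₁~c₂ = inj₂ (inj₁ refl)
    ; c₃~c₄ = inj₁ (inj₁ refl)
    ; c₁≁c₄ = λ { (inj₁ (inj₁ ())) ; (inj₁ (inj₂ (() , _))) ; (inj₂ (inj₁ ())) ; (inj₂ (inj₂ (_ , ()))) }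
    ; c₃≁c₂ = λ { (inj₁ (inj₁ ())) ; (inj₁ (inj₂ (() , _))) ; (inj₂ (inj₁ ())) ; (inj₂ (inj₂ (() , _))) }
    ; m~c₁ = inj₂ (inj₁ refl)
    ; m~c₃ = inj₁ (inj₁ refl)
    ; obstructed₁ = cycle-obstructed 1F
    ; obstructed₂ = cycle-obstructed 0F
    ; obstructed₃ = cycle-obstructed 3F
    ; obstructed₄ = cycle-obstructed 4F
    }

hole⇒twisted : (G : Graph) → HasHole G → Obstruction.Twisted G
hole⇒twisted G (_ , 6≤n@(s≤s (s≤s (s≤s (s≤s (s≤s (s≤s z≤n)))))) , e) =
  ⊑-twisted (cycle _ (ℕ.≤-trans 3≤6 6≤n)) G e (cycle-twisted _ (ℕ.≤-trans 3≤6 6≤n))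

-- Colour classes, and recognising a domino in a bipartite graph.

module Sides (G : Graph) (bipartite : Bipartite G) where
  open Graph G
  open Obstruction G using (~⇒≢)

  side : Vertex → Bool
  side = proj₁ bipartite

  opposite : ∀ {u v} → u ~ v → side u ≡ not (side v)
  opposite e = ¬-not (proj₂ bipartite e)

  distance-2 : ∀ {u v w} → u ~ v → v ~ w → side u ≡ side w
  distance-2 {w = w} u~v v~w =
    trans (opposite u~v) (trans (cong not (opposite v~w)) (not-involutive (side w)))

  same-side : ∀ {u v} → side u ≡ side v → ¬ u ~ v
  same-side eq e = proj₂ bipartite e eq

  -- The edges put 0, 2, 4 into one class and 1, 3, 5 into the other. Across the classes only the
  -- three antipodal pairs are not hexagon edges, and one of them is the chord, so just two
  -- non-adjacencies have to be supplied.
  domino-embedding : (f : Fin 6 → Vertex) →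
    f 0F ~ f 1F → f 1F ~ f 2F → f 2F ~ f 3F → f 3F ~ f 4F → f 4F ~ f 5F → f 5F ~ f 0F → f 0F ~ f 3F →
    ¬ f 1F ~ f 4F → ¬ f 2F ~ f 5F → domino ⊑ G
  domino-embedding f e01 e12 e23 e34 e45 e50 e03 n14 n25 = mk↣ injective , agree
    where
    module D = Graph domino

    Agree : Fin 6 → Fin 6 → Set
    Agree i j = (i D.~ j) ⇔ (f i ~ f j)

    on : ∀ {i j} {p : True (i D.~? j)} → f i ~ f j → Agree i j
    on {p = p} e = mk⇔ (λ _ → e) (λ _ → toWitness p)

    off : ∀ {i j} {p : False (i D.~? j)} → ¬ f i ~ f j → Agree i j
    off {p = p} n = mk⇔ (λ d → contradiction d (toWitnessFalse p)) (λ e → contradiction e n)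

    s02 = distance-2 e01 e12
    s04 = distance-2 e03 e34
    s24 = trans (sym s02) s04
    s13 = distance-2 e12 e23
    s15 = distance-2 (~-sym e01) (~-sym e50)
    s35 = distance-2 e34 e45

    agree : ∀ i j → Agree i j
    agree 0F 0F = off ~-irrefl
    agree 0F 1F = on e01
    agree 0F 2F = off (same-side s02)
    agree 0F 3F = on e03
    agree 0F 4F = off (same-side s04)
    agree 0F 5F = on (~-sym e50)
    agree 1F 0F = on (~-sym e01)
    agree 1F 1F = off ~-irrefl
    agree 1F 2F = on e12
    agree 1F 3F = off (same-side s13)
    agree 1F 4F = off n14
    agree 1F 5F = off (same-side s15)
    agree 2F 0F = off (same-side (sym s02))
    agree 2F 1F = on (~-sym e12)
    agree 2F 2F = off ~-irrefl
    agree 2F 3F = on e23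
    agree 2F 4F = off (same-side s24)
    agree 2F 5F = off n25
    agree 3F 0F = on (~-sym e03)
    agree 3F 1F = off (same-side (sym s13))
    agree 3F 2F = on (~-sym e23)
    agree 3F 3F = off ~-irrefl
    agree 3F 4F = on e34
    agree 3F 5F = off (same-side s35)
    agree 4F 0F = off (same-side (sym s04))
    agree 4F 1F = off (n14 ∘ ~-sym)
    agree 4F 2F = off (same-side (sym s24))
    agree 4F 3F = on (~-sym e34)
    agree 4F 4F = off ~-irrefl
    agree 4F 5F = on e45
    agree 5F 0F = on e50
    agree 5F 1F = off (same-side (sym s15))
    agree 5F 2F = off (n25 ∘ ~-sym)
    agree 5F 3F = off (same-side (sym s35))
    agree 5F 4F = on (~-sym e45)
    agree 5F 5F = off ~-irrefl

    -- No two vertices of the domino have the same neighbours, so preserving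
    -- and reflecting adjacency already forces injectivity.
    twin-free : ∀ i j → (∀ k → ((i D.~ k) → (j D.~ k)) × ((j D.~ k) → (i D.~ k))) → i ≡ j
    twin-free = from-yes (all? λ i → all? λ j →
      all? (λ k → ((i D.~? k) →-dec (j D.~? k)) ×-dec ((j D.~? k) →-dec (i D.~? k))) →-dec i Fin.≟ j)

    injective : ∀ {i j} → f i ≡ f j → i ≡ j
    injective {i} {j} eq = twin-free i j λ k →
      (λ e → from (agree j k) (subst (_~ f k) eq (to (agree i k) e))) ,
      (λ e → from (agree i k) (subst (_~ f k) (sym eq) (to (agree j k) e)))

-- Induced paths, and closing them to induced cycles.

module Paths (G : Graph) where
  open Graph G
  open Obstruction G

  data InducedPath : List Vertex → Set where
    [_] : ∀ x → InducedPath (x ∷ [])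
    _∷_ : ∀ {x y l} → x ~ y × All (Apart x) l → InducedPath (y ∷ l) → InducedPath (x ∷ y ∷ l)

  data OnlyLast (c : Vertex) : List Vertex → Set where
    [_] : ∀ {x} → c ~ x → OnlyLast c (x ∷ [])
    _∷_ : ∀ {x l} → Apart c x → OnlyLast c l → OnlyLast c (x ∷ l)

  Consecutive : ℕ → ℕ → Set
  Consecutive i j = j ≡ suc i ⊎ i ≡ suc j

  path-adjacency : ∀ {l} → InducedPath l → ∀ i j →
    (lookup l i ~ lookup l j) ⇔ Consecutive (toℕ i) (toℕ j)
  path-adjacency {_ ∷ _} p zero zero = mk⇔ (⊥-elim ∘ ~-irrefl) λ { (inj₁ ()) ; (inj₂ ()) }
  path-adjacency ((x~y , _) ∷ _) zero (suc zero) = mk⇔ (λ _ → inj₁ refl) (λ _ → x~y)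
  path-adjacency ((_ , apart) ∷ _) zero (suc (suc j)) =
    mk⇔ (λ e → contradiction e (proj₂ (All.lookup apart (∈-lookup j)))) λ { (inj₁ ()) ; (inj₂ ()) }
  path-adjacency ((x~y , _) ∷ _) (suc zero) zero = mk⇔ (λ _ → inj₂ refl) (λ _ → ~-sym x~y)
  path-adjacency ((_ , apart) ∷ _) (suc (suc i)) zero =
    mk⇔ (λ e → contradiction (~-sym e) (proj₂ (All.lookup apart (∈-lookup i)))) λ { (inj₁ ()) ; (inj₂ ()) }
  path-adjacency (_ ∷ p) (suc i) (suc j) = shift ⇔-∘ path-adjacency p i j
    where
    shift : Consecutive (toℕ i) (toℕ j) ⇔ Consecutive (suc (toℕ i)) (suc (toℕ j))
    shift = mk⇔ (Sum.map (cong suc) (cong suc)) (Sum.map ℕ.suc-injective ℕ.suc-injective)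

  head-≢ : ∀ {x l} → InducedPath (x ∷ l) → ∀ i → x ≢ lookup l i
  head-≢ ((x~y , _) ∷ _) zero    = ~⇒≢ x~y
  head-≢ ((_ , apart) ∷ _) (suc i) = proj₁ (All.lookup apart (∈-lookup i))

  path-injective : ∀ {l} → InducedPath l → ∀ i j → lookup l i ≡ lookup l j → i ≡ j
  path-injective {_ ∷ _} p zero zero eq = refl
  path-injective {_ ∷ _} p zero (suc j) eq = contradiction eq (head-≢ p j)
  path-injective {_ ∷ _} p (suc i) zero eq = contradiction (sym eq) (head-≢ p i)
  path-injective (_ ∷ p) (suc i) (suc j) eq = cong suc (path-injective {_ ∷ _} p i j eq)

  last-adjacency : ∀ {c l} → OnlyLast c l → ∀ i → (c ~ lookup l i) ⇔ (suc (toℕ i) ≡ length l)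
  last-adjacency [ e ] zero = mk⇔ (λ _ → refl) (λ _ → e)
  last-adjacency ((_ , c≁x) ∷ [ _ ]) zero = mk⇔ (λ e → contradiction e c≁x) λ ()
  last-adjacency ((_ , c≁x) ∷ (_ ∷ _)) zero = mk⇔ (λ e → contradiction e c≁x) λ ()
  last-adjacency (_ ∷ o) (suc i) = mk⇔ (cong suc) ℕ.suc-injective ⇔-∘ last-adjacency o i

  last-≢ : ∀ {c l} → OnlyLast c l → ∀ i → c ≢ lookup l i
  last-≢ [ e ] zero = ~⇒≢ e
  last-≢ ((c≢x , _) ∷ _) zero = c≢x
  last-≢ (_ ∷ o) (suc i) = last-≢ o i

  -- With `c` at index 0 and the path numbered from 1, the edge from `c` to the end of `l` becomes
  -- the wrap-around edge.
  close-cycle : ∀ {c p l} → c ~ p → OnlyLast c l → InducedPath (p ∷ l) →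
    (3≤n : 3 ≤ 2 ℕ.+ length l) → cycle (2 ℕ.+ length l) 3≤n ⊑ G
  close-cycle {c} {p} {l} c~p only path 3≤n = mk↣ (injective _ _) , adjacency
    where
    n = 2 ℕ.+ length l

    f : Fin n → Vertex
    f = lookup (c ∷ p ∷ l)

    c≢ : ∀ i → c ≢ f (suc i)
    c≢ zero    = ~⇒≢ c~p
    c≢ (suc i) = last-≢ only i

    injective : ∀ i j → f i ≡ f j → i ≡ j
    injective zero    zero    eq = refl
    injective zero    (suc j) eq = contradiction eq (c≢ j)
    injective (suc i) zero    eq = contradiction (sym eq) (c≢ i)
    injective (suc i) (suc j) eq = cong suc (path-injective path i j eq)

    c~ : ∀ i → (Next n zero (suc i) ⊎ Next n (suc i) zero) ⇔ (c ~ f (suc i))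
    c~ zero = mk⇔ (λ _ → c~p) (λ _ → inj₁ (inj₁ refl))
    c~ (suc i) = mk⇔
      (λ { (inj₁ (inj₁ ())) ; (inj₁ (inj₂ (_ , ()))) ; (inj₂ (inj₁ ()))
         ; (inj₂ (inj₂ (eq , _))) → from (last-adjacency only i) (ℕ.suc-injective (ℕ.suc-injective eq)) })
      (λ e → inj₂ (inj₂ (cong (2 ℕ.+_) (to (last-adjacency only i) e) , refl)))

    adjacency : ∀ i j → (Next n i j ⊎ Next n j i) ⇔ (f i ~ f j)
    adjacency zero zero = mk⇔ (⊥-elim ∘ [ next-irrefl 3≤n , next-irrefl 3≤n ]′) (⊥-elim ∘ ~-irrefl)
    adjacency zero (suc j) = c~ j
    adjacency (suc i) zero = mk⇔ ~-sym ~-sym ⇔-∘ (c~ i ⇔-∘ mk⇔ Sum.swap Sum.swap)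
    adjacency (suc i) (suc j) = ⇔-sym (path-adjacency path i j) ⇔-∘ mk⇔
      (λ { (inj₁ (inj₁ eq)) → inj₁ (ℕ.suc-injective eq) ; (inj₁ (inj₂ (_ , ())))
         ; (inj₂ (inj₂ (_ , ()))) ; (inj₂ (inj₁ eq)) → inj₂ (ℕ.suc-injective eq) })
      [ inj₁ ∘ inj₁ ∘ cong suc , inj₂ ∘ inj₁ ∘ cong suc ]′

-- Absence of obstructed vertices in bipartite graphs without holes and dominoes.

module Unobstructed (G : Graph) (bipartite : Bipartite G)
  (hole-free : ¬ HasHole G) (domino-free : ¬ (domino ⊑ G)) where
  open Graph G
  open Obstruction G
  open Paths G
  open Sides G bipartite

  no-long-cycle : ∀ {c p l} → c ~ p → OnlyLast c l → InducedPath (p ∷ l) → ¬ 6 ≤ 2 ℕ.+ length l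
  no-long-cycle c~p only path 6≤n =
    hole-free (_ , 6≤n , close-cycle c~p only path (ℕ.≤-trans 3≤6 6≤n))

  module _ {z a : Vertex} (z~a : z ~ a) where

    -- The vertices at distance more than 2 from `z`.
    Untouched : Vertex → Set
    Untouched w = Apart z w × (∀ {b} → z ~ b → ¬ b ~ w)

    -- The shortcut walk read backwards, from its current end to the last vertex `t` at distance 2
    -- from `z`, which is known to be adjacent to `a`.
    data Trail (t : Vertex) : List Vertex → Set where
      [_] : Apart z t × a ~ t → Trail t (t ∷ [])
      _∷_ : ∀ {w l} → Untouched w → Trail t l → Trail t (w ∷ l)

    trail-end : ∀ {t l} → Trail t l → a ~ t
    trail-end [ _ , a~t ] = a~t
    trail-end (_ ∷ r)     = trail-end r

    trail-length : ∀ {t l} → Trail t l → 1 ≤ length l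
    trail-length [ _ ]   = s≤s z≤n
    trail-length (_ ∷ _) = s≤s z≤n

    trail-apart : ∀ {t l} → Trail t l → All (Apart z) l
    trail-apart [ p , _ ]     = p ∷ []
    trail-apart ((p , _) ∷ r) = p ∷ trail-apart r

    ≢-apart : ∀ {b w} → z ~ b → Apart z w → b ≢ w
    ≢-apart z~b (_ , z≁w) refl = z≁w z~b

    trail-only-last : ∀ {t l b} → z ~ b → b ~ t → Trail t l → OnlyLast b l
    trail-only-last z~b b~t [ _ ]         = [ b~t ]
    trail-only-last z~b b~t ((p , n) ∷ r) = (≢-apart z~b p , n z~b) ∷ trail-only-last z~b b~t r

    trail-avoids : ∀ {t l b} → z ~ b → ¬ b ~ t → Trail t l → All (Apart b) l
    trail-avoids z~b b≁t [ p , _ ]     = (≢-apart z~b p , b≁t) ∷ []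
    trail-avoids z~b b≁t ((p , n) ∷ r) = (≢-apart z~b p , n z~b) ∷ trail-avoids z~b b≁t r

    -- If `a` missed `w`, the induced path from `w` to `t` could be closed to an induced cycle:
    -- through `b` alone when `b` sees `t`, and through `a`, `z`, `b` otherwise. Where no hole
    -- arises, there is a domino or a conflict with the bipartition.
    segment : ∀ {t w l b} → InducedPath (w ∷ l) → Trail t l → Apart z w → z ~ b → b ~ w → a ~ w
    segment ((w~t , _) ∷ _) [ _ , a~t ] w-apart z~b b~w = contradiction w~t
      (same-side (trans (distance-2 (~-sym b~w) (~-sym z~b)) (distance-2 z~a a~t)))
    segment {t} {w} {b = b} path trail@(_ ∷ r) w-apart z~b b~w with a ~? w | b ~? t
    ... | yes a~w | _ = a~w
    -- The cycle `a`, `z`, `b`, `w`, ..., `t` has length at least 6, because `l` has at least two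
    -- vertices.
    ... | no a≁w | no b≁t = contradiction (s≤s (s≤s (s≤s (s≤s (s≤s (trail-length r))))))
      (no-long-cycle (~-sym z~a)
        (((λ { refl → a≁w b~w }) , same-side (distance-2 (~-sym z~a) z~b)) ∷
         (≢-apart z~a w-apart , a≁w) ∷ trail-only-last z~a (trail-end trail) trail)
        ((z~b , w-apart ∷ trail-apart trail) ∷ (b~w , trail-avoids z~b b≁t trail) ∷ path))
    -- Here the cycle through `b` is a square; with `z` and `a` it forms the hexagon b, z, a, t, m,
    -- w with chord bt.
    segment ((w~m , _) ∷ (m~t , _) ∷ _) (((_ , z≁m) , _) ∷ [ _ , a~t ]) _ z~b b~w | no a≁w | yes b~t =
      contradiction (domino-embedding (lookup (_ ∷ _ ∷ _ ∷ _ ∷ _ ∷ _ ∷ []))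
        (~-sym z~b) z~a a~t (~-sym m~t) (~-sym w~m) (~-sym b~w) b~t z≁m a≁w) domino-free
    segment ((w~m , _) ∷ (m~n , _) ∷ (n~t , _) ∷ _) (_ ∷ _ ∷ [ _ ]) _ z~b b~w | no _ | yes b~t =
      contradiction n~t (same-side (trans (sym (distance-2 w~m m~n)) (distance-2 (~-sym b~w) b~t)))
    segment path trail@(_ ∷ _ ∷ _ ∷ r) _ z~b b~w | no _ | yes b~t =
      contradiction (s≤s (s≤s (s≤s (s≤s (s≤s (trail-length r))))))
        (no-long-cycle b~w (trail-only-last z~b b~t trail) path)

    -- The vertex `x` is attached at the last path vertex that equals or neighbours it. Dropping all
    -- earlier vertices keeps the path induced.
    extend : ∀ {t l} x → InducedPath l → Trail t l → Any (λ w → x ≡ w ⊎ x ~ w) l →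
      a ~ x ⊎ (∃[ l′ ] InducedPath (x ∷ l′) × Trail t l′)
    extend x path [ _ , a~t ] (here (inj₁ refl)) = inj₁ a~t
    extend x path trail@([ _ ]) (here (inj₂ x~t)) = inj₂ (_ , (x~t , []) ∷ path , trail)
    extend x ((w~y , apart) ∷ path) (u ∷ trail) near
      with Any.any? (λ w → (x Fin.≟ w) ⊎-dec (x ~? w)) _
    ... | yes later = extend x path trail later
    ... | no ¬later with near
    ...   | here (inj₁ refl) = inj₂ (_ , (w~y , apart) ∷ path , trail)
    ...   | here (inj₂ x~w)  = inj₂ (_ ,
      (x~w , All.map (λ n → n ∘ inj₁ , n ∘ inj₂) (¬Any⇒All¬ _ ¬later)) ∷ (w~y , apart) ∷ path ,
      u ∷ trail)
    ...   | there later      = contradiction later ¬later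

    -- Induction along the walk. A new vertex at distance 2 from `z` is adjacent to `a`, if need be
    -- by `segment`, and the trail restarts there; every other new vertex goes in front of the
    -- shortened trail.
    follow : ∀ {x y} → a ~ x → Reach z x y → ∃₂ λ t l → InducedPath (y ∷ l) × Trail t (y ∷ l)
    follow a~x (start p) = _ , _ , [ _ ] , [ p , a~x ]
    follow a~x (step {y = y} r w~y p) with follow a~x r
    ... | t , l , path , trail with extend y path trail (here (inj₂ (~-sym w~y)))
    ...   | inj₁ a~y = _ , _ , [ _ ] , [ p , a~y ]
    ...   | inj₂ (_ , path′ , trail′) with any? (λ b → (z ~? b) ×-dec (b ~? y))
    ...     | yes (b , z~b , b~y) = _ , _ , [ _ ] , [ p , segment path′ trail′ p z~b b~y ]
    ...     | no ¬touched = _ , _ , path′ , (p , λ z~b b~y → ¬touched (_ , z~b , b~y)) ∷ trail′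

  unobstructed : ∀ z → ¬ Obstructed z
  unobstructed z (a , a′ , x , y , z~a , z~a′ , a~x , a′~y , r , a≁y)
    with follow z~a a~x r
  -- Since `a′` joins `z` to `y`, the vertex `y` is not untouched, so the trail can only be `y`
  -- alone.
  ... | _ , _ , _ , [ _ , a~y ]      = a≁y a~y
  ... | _ , _ , _ , (_ , n) ∷ _ = n z~a′ a′~y

-- Reversing walks, and symmetries of pivoting.

module _ {G : Graph} where
  open Graph G
  open Obstruction G

  reach-apartˡ : ∀ {z x y} → Reach z x y → Apart z x
  reach-apartˡ (start p)    = p
  reach-apartˡ (step r _ _) = reach-apartˡ r

  reach-apartʳ : ∀ {z x y} → Reach z x y → Apart z y
  reach-apartʳ (start p)    = p
  reach-apartʳ (step _ _ p) = p

  reach-trans : ∀ {z x y w} → Reach z x y → Reach z y w → Reach z x w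
  reach-trans r (start _)    = r
  reach-trans r (step s e p) = step (reach-trans r s) e p

  reach-sym : ∀ {z x y} → Reach z x y → Reach z y x
  reach-sym (start p)    = start p
  reach-sym (step r e p) = reach-trans (step (start p) (~-sym e) (reach-apartʳ r)) (reach-sym r)

△-cong : ∀ {A A′ B B′ : Set} → A ⇔ A′ → B ⇔ B′ → (A △ B) ⇔ (A′ △ B′)
△-cong p q = (p ×-⇔ ¬-cong-⇔ q) ⊎-⇔ (q ×-⇔ ¬-cong-⇔ p)

-- Lets a result about the end `u` of the pivot edge be reused for the end `v`.
pivot-swap : (G : Graph) {u v : Graph.Vertex G} (u~v : Graph._~_ G u v) (v~u : Graph._~_ G v u) →
  pivot G (u , v , u~v) ⊑ pivot G (v , u , v~u)
pivot-swap G _ _ = ↣-id _ , λ a b → △-cong (⇔-id _) (⇔-id _ ×-⇔ mk⇔ exchange exchange)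
  where
  exchange : ∀ {A B C D : Set} → (A × B) ⊎ (C × D) → (D × C) ⊎ (B × A)
  exchange = Sum.map swap swap ∘ Sum.swap

-- Obstructed vertices after a pivot.

module Pivot (G : Graph) (bipartite : Bipartite G)
  (unobstructed : ∀ z → ¬ Obstruction.Obstructed G z) where
  open Graph G
  open Obstruction G
  open Sides G bipartite

  -- The hypothesis in positive form: neighbours of `z` attached to the same component outside the
  -- closed neighbourhood of `z` have the same neighbours in that component.
  level : ∀ {z a a′ x y} → z ~ a → z ~ a′ → a ~ x → a′ ~ y → Reach z x y → a ~ y
  level {z} {a} {y = y} z~a z~a′ a~x a′~y r with a ~? y
  ... | yes a~y = a~y
  ... | no a≁y  = contradiction (_ , _ , _ , _ , z~a , z~a′ , a~x , a′~y , r , a≁y) (unobstructed z)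

  module _ {u v : Vertex} (u~v : u ~ v) where
    private
      H = pivot G (u , v , u~v)
      module H where
        open Graph H public
        open Obstruction H public

    -- Cross and Toggled are local to the definition of pivot.
    Cross Toggled : Vertex → Vertex → Set
    Cross a b = (u ~ a × a ≢ v) × (v ~ b × b ≢ u)
    Toggled a b = a ≢ b × (Cross a b ⊎ Cross b a)

    opposite-ends : ∀ {a b} → u ~ a → v ~ b → side a ≢ side b
    opposite-ends u~a v~b eq = same-side (trans (distance-2 (~-sym u~v) u~a) eq) v~b

    pivot-bipartite : Bipartite H
    pivot-bipartite = side , λ
      { (inj₁ (e , _)) → proj₂ bipartite e
      ; (inj₂ ((_ , inj₁ ((u~a , _) , (v~b , _))) , _)) → opposite-ends u~a v~b
      ; (inj₂ ((_ , inj₂ ((u~b , _) , (v~a , _))) , _)) → opposite-ends u~b v~a ∘ sym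
      }

    module Far {z : Vertex} (z≁u : ¬ z ~ u) (z≁v : ¬ z ~ v) where
      apart-u : Apart z u
      apart-u = (λ { refl → z≁v u~v }) , z≁u

      apart-v : Apart z v
      apart-v = (λ { refl → z≁u (~-sym u~v) }) , z≁v

      untoggled : ∀ {b} → ¬ Toggled z b
      untoggled (_ , inj₁ ((u~z , _) , _)) = z≁u (~-sym u~z)
      untoggled (_ , inj₂ (_ , (v~z , _))) = z≁v (~-sym v~z)

      neighbour : ∀ {b} → z H.~ b → z ~ b
      neighbour (inj₁ (e , _)) = e
      neighbour (inj₂ (t , _)) = contradiction t untoggled

      apart : ∀ {w} → H.Apart z w → Apart z w
      apart (z≢w , z≁w) = z≢w , λ e → z≁w (inj₁ (e , untoggled))

      -- A created edge is replaced by a detour over `u` and `v`, which are both apart from `z`.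
      reach : ∀ {x y} → H.Reach z x y → Reach z x y
      reach (H.start p) = start (apart p)
      reach (H.step r (inj₁ (e , _)) p) = step (reach r) e (apart p)
      reach (H.step r (inj₂ ((_ , inj₁ ((u~w , _) , (v~y , _))) , _)) p) =
        step (step (step (reach r) (~-sym u~w) apart-u) u~v apart-v) v~y (apart p)
      reach (H.step r (inj₂ ((_ , inj₂ ((u~y , _) , (v~w , _))) , _)) p) =
        step (step (step (reach r) (~-sym v~w) apart-v) (~-sym u~v) apart-u) u~y (apart p)

      Touches : Vertex → Vertex → Set
      Touches b y = ∃[ x ] b ~ x × Reach z x y

      touches : ∀ {b y} → Apart z y → b H.~ y → Touches b y
      touches p (inj₁ (b~y , _)) = _ , b~y , start p
      touches p (inj₂ ((_ , inj₁ ((u~b , _) , (v~y , _))) , _)) =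
        u , ~-sym u~b , step (step (start apart-u) u~v apart-v) v~y p
      touches p (inj₂ ((_ , inj₂ ((u~y , _) , (v~b , _))) , _)) =
        v , ~-sym v~b , step (step (start apart-v) (~-sym u~v) apart-u) u~y p

      module _ {b b′ y : Vertex} (z~b : z ~ b) (z~b′ : z ~ b′) (touch′ : Touches b′ y) where
        adjacent : ∀ {w} → Reach z y w → b ~ w → b′ ~ w
        adjacent r b~w = let _ , b′~x , s = touch′ in level z~b′ z~b b′~x b~w (reach-trans s r)

        -- If the pair is toggled, `y` is adjacent to `u` or `v`, so both lie in the component of
        -- `y`, and there `b′` has every neighbour that `b` has.
        toggled : Apart z y → Toggled b y → Toggled b′ y
        toggled p@(_ , z≁y) (_ , c) = (λ { refl → z≁y z~b′ }) , Sum.map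
          (λ ((u~b , _) , (v~y , y≢u)) →
            (~-sym (adjacent (step (step (start p) (~-sym v~y) apart-v) (~-sym u~v) apart-u) (~-sym u~b)) ,
             λ { refl → z≁v z~b′ }) , (v~y , y≢u))
          (λ ((u~y , y≢v) , (v~b , _)) → (u~y , y≢v) ,
            (~-sym (adjacent (step (step (start p) (~-sym u~y) apart-u) u~v apart-v) (~-sym v~b)) ,
             λ { refl → z≁u z~b′ }))
          c

      -- Both `a` and `a′` are attached in `G` to the component of `y`. They therefore agree on
      -- adjacency to `y` and on being toggled with `y`, hence also on adjacency to `y` in the
      -- pivot.
      far-unobstructed : ¬ H.Obstructed z
      far-unobstructed (a , a′ , x , y , z~a , z~a′ , a~x , a′~y , walk , a≁y) = a≁y (adjacent-in-H a′~y)
        where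
        r = reach walk
        p = reach-apartʳ r
        touch-a : Touches a y
        touch-a = let w , a~w , s = touches (reach-apartˡ r) a~x in w , a~w , reach-trans s r
        touch-a′ : Touches a′ y
        touch-a′ = touches p a′~y
        adjacent-in-H : a′ H.~ y → a H.~ y
        adjacent-in-H = Sum.map
          (λ (e , ¬t) → adjacent (neighbour z~a′) (neighbour z~a) touch-a (start p) e ,
                        ¬t ∘ toggled (neighbour z~a) (neighbour z~a′) touch-a′ p)
          (λ (t , ¬e) → toggled (neighbour z~a′) (neighbour z~a) touch-a p t ,
                        ¬e ∘ adjacent (neighbour z~a) (neighbour z~a′) touch-a′ (start p))

    -- How an edge a–x of the pivot, with a a neighbour of u and x apart from u,
    -- arises in G.
    data Origin (a x : Vertex) : Set where
      end     : a ≡ v → v ~ x → Origin a x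
      kept    : a ≢ v → a ~ x → ¬ v ~ x → Origin a x
      created : a ≢ v → ¬ a ~ x → v ~ x → Origin a x

    module End where
      untoggled : ∀ {b} → ¬ Toggled u b
      untoggled (_ , inj₁ ((u~u , _) , _)) = ~-irrefl u~u
      untoggled (_ , inj₂ (_ , (_ , u≢u))) = u≢u refl

      neighbour : ∀ {b} → u H.~ b → u ~ b
      neighbour (inj₁ (e , _)) = e
      neighbour (inj₂ (t , _)) = contradiction t untoggled

      apart : ∀ {w} → H.Apart u w → Apart u w
      apart (u≢w , u≁w) = u≢w , λ e → u≁w (inj₁ (e , untoggled))

      -- Every toggled pair meets the neighbourhood of `u`, so a walk apart from `u` uses no created
      -- edge.
      reach : ∀ {x y} → H.Reach u x y → Reach u x y
      reach (H.start p) = start (apart p)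
      reach (H.step r (inj₁ (e , _)) p) = step (reach r) e (apart p)
      reach (H.step r (inj₂ ((_ , inj₁ ((u~w , _) , _)) , _)) _) =
        contradiction u~w (proj₂ (reach-apartʳ (reach r)))
      reach (H.step _ (inj₂ ((_ , inj₂ ((u~y , _) , _)) , _)) p) =
        contradiction u~y (proj₂ (apart p))

      toggled : ∀ {a x} → u ~ a → Apart u x → a ≢ v → v ~ x → Toggled a x
      toggled u~a (u≢x , u≁x) a≢v v~x =
        (λ { refl → u≁x u~a }) , inj₁ ((u~a , a≢v) , (v~x , u≢x ∘ sym))

      origin : ∀ {a x} → u ~ a → Apart u x → a H.~ x → Origin a x
      origin {a} u~a p (inj₁ (a~x , ¬t)) with a Fin.≟ v
      ... | yes refl = end refl a~x
      ... | no a≢v   = kept a≢v a~x (¬t ∘ toggled u~a p a≢v)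
      origin u~a p (inj₂ ((_ , inj₁ ((_ , a≢v) , (v~x , _))) , a≁x)) = created a≢v a≁x v~x
      origin u~a (_ , u≁x) (inj₂ ((_ , inj₂ ((u~x , _) , _)) , _)) = contradiction u~x u≁x

      origin⁻¹ : ∀ {a x} → u ~ a → Apart u x → Origin a x → a H.~ x
      origin⁻¹ u~a _ (end refl v~x) = inj₁ (v~x , λ
        { (_ , inj₁ ((_ , v≢v) , _)) → v≢v refl ; (_ , inj₂ (_ , (v~v , _))) → ~-irrefl v~v })
      origin⁻¹ _ (_ , u≁x) (kept a≢v a~x v≁x) = inj₁ (a~x , λ
        { (_ , inj₁ (_ , (v~x , _))) → v≁x v~x ; (_ , inj₂ ((u~x , _) , _)) → u≁x u~x })
      origin⁻¹ u~a p (created a≢v a≁x v~x) = inj₂ (toggled u~a p a≢v v~x , a≁x)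

      -- By `level` at `u`, two neighbours of `u` attached to the component of `x` and `y` agree on
      -- it. Applied to `v`, this shows that `kept` occurs at both ends or at neither. In the first
      -- case `a` and `a′` agree; in the second `v` sees `y`, and `a` sees `y` only if it sees `x`.
      transport : ∀ {a a′ x y} → u ~ a → u ~ a′ → Reach u x y → Origin a x → Origin a′ y → Origin a y
      transport {a} {a′} {x} {y} u~a u~a′ r = go
        where
        s = reach-sym r
        go : Origin a x → Origin a′ y → Origin a y
        go (end a≡v v~x)         (end _ v~y)         = end a≡v v~y
        go (end a≡v v~x)         (created _ _ v~y)   = end a≡v v~y
        go (end _ v~x)           (kept _ a′~y v≁y)   = contradiction (level u~v u~a′ v~x a′~y r) v≁y
        go (kept a≢v a~x _)      (kept _ a′~y v≁y)   = kept a≢v (level u~a u~a′ a~x a′~y r) v≁y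
        go (kept _ a~x v≁x)      (end _ v~y)         = contradiction (level u~v u~a v~y a~x s) v≁x
        go (kept _ a~x v≁x)      (created _ _ v~y)   = contradiction (level u~v u~a v~y a~x s) v≁x
        go (created a≢v a≁x v~x) (end _ v~y)         = created a≢v (λ a~y → a≁x (level u~a u~v a~y v~x s)) v~y
        go (created a≢v a≁x v~x) (created _ _ v~y)   = created a≢v (λ a~y → a≁x (level u~a u~v a~y v~x s)) v~y
        go (created _ _ v~x)     (kept _ a′~y v≁y)   = contradiction (level u~v u~a′ v~x a′~y r) v≁y

      end-unobstructed : ¬ H.Obstructed u
      end-unobstructed (a , a′ , x , y , u~a , u~a′ , a~x , a′~y , walk , a≁y) =
        a≁y (origin⁻¹ (neighbour u~a) (reach-apartʳ r) (transport (neighbour u~a) (neighbour u~a′) r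
          (origin (neighbour u~a) (reach-apartˡ r) a~x)
          (origin (neighbour u~a′) (reach-apartʳ r) a′~y)))
        where r = reach walk

  module _ {u v : Vertex} (u~v : u ~ v) where
    private
      H = pivot G (u , v , u~v)
      module H where
        open Graph H public
        open Obstruction H public

    obstructed⇒near : ∀ {z} → H.Obstructed z → (u ~ z × z ≢ v) ⊎ (v ~ z × z ≢ u)
    obstructed⇒near {z} o with u ~? z | v ~? z
    ... | no u≁z | no v≁z = contradiction o (Far.far-unobstructed u~v (u≁z ∘ ~-sym) (v≁z ∘ ~-sym))
    -- The case that `z` is `v` is reduced to that of `u` by exchanging the ends of the edge.
    ... | yes u~z | _ = inj₁ (u~z , λ { refl → End.end-unobstructed (~-sym u~v)
                          (⊑-obstructed H (pivot G (v , u , ~-sym u~v)) (pivot-swap G u~v (~-sym u~v)) o) })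
    ... | no _ | yes v~z = inj₂ (v~z , λ { refl → End.end-unobstructed u~v o })

    -- The pivot complements the adjacency between the two edges c₁c₂ and c₃c₄,
    -- so together with uv they form a domino in G.
    near⇒domino : ∀ {c₁ c₂ c₃ c₄} →
      u ~ c₁ × c₁ ≢ v → v ~ c₂ × c₂ ≢ u → u ~ c₃ × c₃ ≢ v → v ~ c₄ × c₄ ≢ u →
      c₁ H.~ c₂ → c₃ H.~ c₄ → ¬ c₁ H.~ c₄ → ¬ c₃ H.~ c₂ → domino ⊑ G
    near⇒domino n₁@(u~c₁ , _) n₂@(v~c₂ , _) n₃@(u~c₃ , _) n₄@(v~c₄ , _) e12 e34 n14 n32 =
      -- The hexagon is u, c₁, c₄, v, c₂, c₃, and its chord is uv.
      domino-embedding (lookup (_ ∷ _ ∷ _ ∷ _ ∷ _ ∷ _ ∷ []))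
        u~c₁ (gained n₁ n₄ n14) (~-sym v~c₄) v~c₂ (~-sym (gained n₃ n₂ n32)) (~-sym u~c₃) u~v
        (lost n₁ n₂ e12) (lost n₃ n₄ e34 ∘ ~-sym)
      where
      toggled : ∀ {a b} → u ~ a × a ≢ v → v ~ b × b ≢ u → Toggled u~v a b
      toggled n m = opposite-ends u~v (proj₁ n) (proj₁ m) ∘ cong side , inj₁ (n , m)

      gained : ∀ {a b} → u ~ a × a ≢ v → v ~ b × b ≢ u → ¬ a H.~ b → a ~ b
      gained {a} {b} n m ¬e with a ~? b
      ... | yes a~b = a~b
      ... | no a≁b  = contradiction (inj₂ (toggled n m , a≁b)) ¬e

      lost : ∀ {a b} → u ~ a × a ≢ v → v ~ b × b ≢ u → a H.~ b → ¬ a ~ b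
      lost n m (inj₁ (_ , ¬t)) _   = ¬t (toggled n m)
      lost n m (inj₂ (_ , ¬e)) a~b = ¬e a~b

    -- All four vertices are near `u` or `v`. Adjacent ones are near different ends, and `c₁` and
    -- `c₃`, being in the same class, are near the same end; so up to exchanging `u` and `v` the
    -- arrangement is that of `near⇒domino`.
    twisted⇒domino : H.Twisted → domino ⊑ G
    twisted⇒domino t = go (obstructed⇒near obstructed₁) (obstructed⇒near obstructed₂)
                          (obstructed⇒near obstructed₃) (obstructed⇒near obstructed₄)
      where
      open H.Twisted t
      module S = Sides H (pivot-bipartite u~v)

      -- `pivot-bipartite` keeps the colouring, so an equality found in the pivot also holds in `G`.
      s₁₃ : side c₁ ≡ side c₃
      s₁₃ = S.distance-2 (H.~-sym m~c₁) m~c₃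

      go : (u ~ c₁ × c₁ ≢ v) ⊎ (v ~ c₁ × c₁ ≢ u) → (u ~ c₂ × c₂ ≢ v) ⊎ (v ~ c₂ × c₂ ≢ u) →
           (u ~ c₃ × c₃ ≢ v) ⊎ (v ~ c₃ × c₃ ≢ u) → (u ~ c₄ × c₄ ≢ v) ⊎ (v ~ c₄ × c₄ ≢ u) → domino ⊑ G
      go (inj₁ n₁) (inj₂ n₂) (inj₁ n₃) (inj₂ n₄) = near⇒domino n₁ n₂ n₃ n₄ c₁~c₂ c₃~c₄ c₁≁c₄ c₃≁c₂
      go (inj₂ n₁) (inj₁ n₂) (inj₂ n₃) (inj₁ n₄) =
        near⇒domino n₂ n₁ n₄ n₃ (H.~-sym c₁~c₂) (H.~-sym c₃~c₄) (c₃≁c₂ ∘ H.~-sym) (c₁≁c₄ ∘ H.~-sym)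
      go (inj₁ (u~c₁ , _)) (inj₁ (u~c₂ , _)) _ _ =
        contradiction c₁~c₂ (S.same-side (distance-2 (~-sym u~c₁) u~c₂))
      go (inj₂ (v~c₁ , _)) (inj₂ (v~c₂ , _)) _ _ =
        contradiction c₁~c₂ (S.same-side (distance-2 (~-sym v~c₁) v~c₂))
      go _ _ (inj₁ (u~c₃ , _)) (inj₁ (u~c₄ , _)) =
        contradiction c₃~c₄ (S.same-side (distance-2 (~-sym u~c₃) u~c₄))
      go _ _ (inj₂ (v~c₃ , _)) (inj₂ (v~c₄ , _)) =
        contradiction c₃~c₄ (S.same-side (distance-2 (~-sym v~c₃) v~c₄))
      go (inj₁ (u~c₁ , _)) _ (inj₂ (v~c₃ , _)) _ = contradiction s₁₃ (opposite-ends u~v u~c₁ v~c₃)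
      go (inj₂ (v~c₁ , _)) _ (inj₁ (u~c₃ , _)) _ = contradiction (sym s₁₃) (opposite-ends u~v u~c₃ v~c₁)

-- Closure of the class under pivoting and along orbits.

BipartiteHoleDominoFree : Graph → Set
BipartiteHoleDominoFree G = Bipartite G × ¬ HasHole G × ¬ (domino ⊑ G)

hereditary : (F G : Graph) → F ⊑ G → BipartiteHoleDominoFree G → BipartiteHoleDominoFree F
hereditary F G F⊑G (bipartite , hole-free , domino-free) =
  ⊑-bipartite F G F⊑G bipartite ,
  (λ (n , 6≤n , e) → hole-free (n , 6≤n , ⊑-trans (cycle n (ℕ.≤-trans 3≤6 6≤n)) F G e F⊑G)) ,
  λ e → domino-free (⊑-trans domino F G e F⊑G)

pivot-closed : (G : Graph) (e : Graph.Edge G) →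
  BipartiteHoleDominoFree G → BipartiteHoleDominoFree (pivot G e)
pivot-closed G e@(u , v , u~v) (bipartite , hole-free , domino-free) =
  P.pivot-bipartite u~v ,
  domino-free ∘ P.twisted⇒domino u~v ∘ hole⇒twisted (pivot G e) ,
  λ d → domino-free (P.twisted⇒domino u~v (⊑-twisted domino (pivot G e) d domino-twisted))
  where module P = Pivot G bipartite (Unobstructed.unobstructed G bipartite hole-free domino-free)

-- Domino-freeness is carried through the induction because being chordal bipartite alone does not
-- survive pivoting. Isomorphisms are absorbed by `hereditary`.
orbit-closed : (G G̃ : Graph) → BipartiteHoleDominoFree G → G̃ ∈Orbit G → BipartiteHoleDominoFree G̃
orbit-closed G G̃ free (m , Gs , first , last , steps) =
  hereditary G̃ (Gs (fromℕ m)) (≅⇒⊑ G̃ (Gs (fromℕ m)) (≅-sym (Gs (fromℕ m)) G̃ last))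
    (<-weakInduction (BipartiteHoleDominoFree ∘ Gs)
      (hereditary (Gs zero) G (≅⇒⊑ (Gs zero) G first) free)
      (λ i free-i →
        let e , iso = steps i
            H = pivot (Gs (inject₁ i)) e
        in hereditary (Gs (suc i)) H (≅⇒⊑ (Gs (suc i)) H iso) (pivot-closed (Gs (inject₁ i)) e free-i))
      (fromℕ m))

-- From an induced domino to a hole in the orbit.

pivot-⊑ : (F G : Graph) (F⊑G : F ⊑ G) ((u , v , u~v) : Graph.Edge F) →
  pivot F (u , v , u~v) ⊑
  pivot G (Injection.to (proj₁ F⊑G) u , Injection.to (proj₁ F⊑G) v , to (proj₂ F⊑G u v) u~v)
pivot-⊑ F G (f , p) (u , v , _) =
  -- Whether a pair is toggled depends only on equalities and on adjacencies to the ends of the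
  -- edge, and an induced embedding preserves and reflects both.
  f , λ a b → △-cong (p a b) (≢-cong a b ×-⇔ (cross a b ⊎-⇔ cross b a))
  where
  ≢-cong : ∀ a b → (a ≢ b) ⇔ (Injection.to f a ≢ Injection.to f b)
  ≢-cong a b = ¬-cong-⇔ (mk⇔ (cong (Injection.to f)) (Injection.injective f))
  cross = λ a b → (p u a ×-⇔ ≢-cong a v) ×-⇔ (p v b ×-⇔ ≢-cong b u)

edge-1-2 : Graph.Edge domino
edge-1-2 = 1F , 2F , toWitness {a? = Graph._~?_ domino 1F 2F} tt

-- Besides each other, `1F` and `2F` have only the neighbours `0F` and `3F`, so the pivot merely
-- deletes the chord.
6-cycle⊑pivot-domino : cycle 6 3≤6 ⊑ pivot domino edge-1-2
6-cycle⊑pivot-domino = ↣-id _ , λ i j → mk⇔ (proj₁ (agree i j)) (proj₂ (agree i j))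
  where
  module C = Graph (cycle 6 3≤6)
  module P = Graph (pivot domino edge-1-2)
  agree : ∀ i j → ((i C.~ j) → (i P.~ j)) × ((i P.~ j) → (i C.~ j))
  agree = from-yes (all? λ i → all? λ j →
    ((i C.~? j) →-dec (i P.~? j)) ×-dec ((i P.~? j) →-dec (i C.~? j)))

domino⇒pivot-hole : (G : Graph) → domino ⊑ G → Σ[ e ∈ Graph.Edge G ] HasHole (pivot G e)
domino⇒pivot-hole G d@(f , p) = e , 6 , ℕ.≤-refl ,
  ⊑-trans (cycle 6 3≤6) (pivot domino edge-1-2) (pivot G e) 6-cycle⊑pivot-domino (pivot-⊑ domino G d edge-1-2)
  where
  e : Graph.Edge G
  e = Injection.to f 1F , Injection.to f 2F , to (p 1F 2F) (proj₂ (proj₂ edge-1-2))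

pivot∈orbit : (G : Graph) (e : Graph.Edge G) → pivot G e ∈Orbit G
pivot∈orbit G e = 1 , (λ { 0F → G ; 1F → pivot G e }) , ≅-refl G , ≅-refl (pivot G e) ,
  λ { 0F → e , ≅-refl (pivot G e) }
  where
  ≅-refl : ∀ F → F ≅ F
  ≅-refl F = ↔-id _ , λ _ _ → ⇔-id _

corollary1 : (G : Graph) → ChordalBipartite G →
    (¬ (domino ⊑ G)) ⇔ ((G̃ : Graph) → G̃ ∈Orbit G → ChordalBipartite G̃)
corollary1 G (bipartite , hole-free) = mk⇔
  (λ domino-free G̃ G̃∈orbit →
    let bipartite′ , hole-free′ , _ = orbit-closed G G̃ (bipartite , hole-free , domino-free) G̃∈orbit
    in bipartite′ , hole-free′)
  (λ chordal d → let e , hole = domino⇒pivot-hole G d in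
    proj₂ (chordal (pivot G e) (pivot∈orbit G e)) hole)
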